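{- Let $(\mathcal M_*,\mathcal M_{\le\omega})$ be a Büchi abstraction (with maps $\alpha_*,\gamma_*,\alpha_{\le\omega},\gamma_{\le\omega}$) that is faithful with respect to a language $\mathfrak A\subseteq\Sigma^{\le\omega}$, i.e. $\gamma_{\le\omega}(\alpha_{\le\omega}(\mathfrak A))=\mathfrak A$. Given a Büchi method typing $M_{\mathfrak A}:\mathit{Sig}\to\mathcal M_*\langle\mathit{Reg}\rangle\times\mathcal M_*\langle\mathit{Sig}\rangle$, one can directly compute an assignment $\eta_{\mathfrak A}:\mathit{Sig}\to\mathcal M_{\le\omega}$ that abstracts the infinitary effect typing $\eta_\gamma:\mathit{Sig}\to\mathcal P(\Sigma^{\le\omega})$ for the concretized method typing $M_{\mathfrak A}^\gamma$; that is, for all $\delta\in\mathit{Sig}$, $$\eta_{\mathfrak A}(\delta)=\alpha_{\le\omega}(\eta_\gamma(\delta)),$$ where $\eta_\gamma$ is the greatest solution in $\mathcal P(\Sigma^{\le\omega})$ of the equation system $\{\delta=\gamma(\mathcal S_\delta)\mid\delta\in\mathit{Sig}\}$ and $\mathcal S_\delta$ is the call expression (second component) of $M_{\mathfrak A}(\delta)$.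
   Context: WORDS. $\Sigma$ is a finite alphabet, $\Sigma^*$ the finite words ($\varepsilon$ the empty word), $\Sigma^{\le\omega}$ the finite and infinite words; $U\cdot V=\{uv\mid u\in U,v\in V\}$ for $U\subseteq\Sigma^*$ and $V\subseteq\Sigma^*$ or $V\subseteq\Sigma^{\le\omega}$; $U^\omega=\{u_1u_2\cdots\mid u_i\in U\}\subseteq\Sigma^{\le\omega}$. $\mathcal P$ is powerset. SIGNATURES. For a Featherweight Java program with classes $\mathit{Cls}$, methods $\mathit{Mtd}$ and finitely many object-creation labels $\ell$, the regions are $\mathit{Reg}\ni r::=\mathtt{Null}\mid\mathtt{CreatedAt}(\ell)\mid\mathtt{Unknown}$. A method signature is a tuple $(C,r,m,\bar s)$ of a class $C$, a region $r$, a method $m$ of $C$, and a list $\bar s$ of regions, one per argument of $m$; $\mathit{Sig}\subseteq\mathit{Cls}\times\mathit{Reg}\times\mathit{Mtd}\times\mathit{Reg}^*$ is the (finite) set of method signatures. BÜCHI ABSTRACTION. A Büchi algebra is a pair of join-semilattices $(\mathcal M_*,\mathcal M_{\le\omega})$ (order $\sqsubseteq$, join $\sqcup$) with monotone operations $\cdot:\mathcal M_*\times\mathcal M_*\to\mathcal M_*$, $\cdot:\mathcal M_*\times\mathcal M_{\le\omega}\to\mathcal M_{\le\omega}$, $(-)^\omega:\mathcal M_*\to\mathcal M_{\le\omega}$, with $\mathcal A\cdot(\mathcal B\cdot\mathcal U)=(\mathcal A\cdot\mathcal B)\cdot\mathcal U$ for $\mathcal A,\mathcal B\in\mathcal M_*$,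 $\mathcal U\in\mathcal M_*\cup\mathcal M_{\le\omega}$. A Galois insertion between partial orders $A$ and $C$ consists of monotone $\alpha:C\to A$, $\gamma:A\to C$ with $\alpha(\gamma(a))=a$ and $\gamma(\alpha(c))\sqsupseteq c$. A Büchi abstraction is a finite Büchi algebra with Galois insertions $(\alpha_*,\gamma_*)$ between $\mathcal M_*$ and $\mathcal P(\Sigma^*)$ and $(\alpha_{\le\omega},\gamma_{\le\omega})$ between $\mathcal M_{\le\omega}$ and $\mathcal P(\Sigma^{\le\omega})$ such that $\alpha_*(A\cdot B)=\alpha_*(A)\cdot\alpha_*(B)$, $\alpha_{\le\omega}(A\cdot V)=\alpha_*(A)\cdot\alpha_{\le\omega}(V)$, $\alpha_{\le\omega}(A^\omega)=\alpha_*(A)^\omega$ for all $A,B\subseteq\Sigma^*$, $V\subseteq\Sigma^{\le\omega}$. EXPRESSIONS. For a set $K$, $\mathcal P(\Sigma^*)\langle K\rangle$ and $\mathcal M_*\langle K\rangle$ are the sets of finite partial functions from $K$ to $\mathcal P(\Sigma^*)$, resp. $\mathcal M_*$ (undefined entries treated as the empty set, resp. the least element). Elements of $\mathcal P(\Sigma^*)\langle\mathit{Sig}\rangle$ and $\mathcal M_*\langle\mathit{Sig}\rangle$ are call expressions, written $\bigcup_i U_i\cdot\delta_i$, resp. $\bigsqcup_i\mathcal A_i\cdot\delta_i$. For $\mathcal T\in\mathcal M_*\langle K\rangle$, $\gamma(\mathcal T)\in\mathcal P(\Sigma^*)\langle K\rangle$ is given by $\gamma(\mathcal T)(x)=\gamma_*(\mathcal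 T(x))$ for $x\in\mathrm{dom}(\mathcal T)$. $M_{\mathfrak A}^\gamma(\delta)=(\gamma(\mathcal T),\gamma(\mathcal S))$ if $M_{\mathfrak A}(\delta)=(\mathcal T,\mathcal S)$. For $S=\bigcup_iU_i\cdot\delta_i$ and $\eta:\mathit{Sig}\to\mathcal P(\Sigma^{\le\omega})$ put $S(\eta)=\bigcup_iU_i\cdot\eta(\delta_i)$. INFINITARY EFFECT TYPING. For a method typing $M:\mathit{Sig}\to\mathcal P(\Sigma^*)\langle\mathit{Reg}\rangle\times\mathcal P(\Sigma^*)\langle\mathit{Sig}\rangle$ with second components $S_\delta$, the infinitary effect typing for $M$ is the greatest (pointwise inclusion) $\eta:\mathit{Sig}\to\mathcal P(\Sigma^{\le\omega})$ with $\eta(\delta)=S_\delta(\eta)$ for all $\delta\in\mathit{Sig}$. A Büchi method typing is a map $M_{\mathfrak A}$ of the type given in the claim that is monotone in the class: $M_{\mathfrak A}(C,r,m,\bar s)\sqsubseteq M_{\mathfrak A}(D,r,m,\bar s)$ (componentwise, pointwise) whenever $C$ is a (reflexive, transitive) subclass of $D$ and $m$ is a method of $D$. -}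

module Defs where

open import Axiom.ExcludedMiddle public using (ExcludedMiddle)
open import Data.Fin.Base using (Fin)
import Data.Fin.Subset as Subset
open import Data.List.Base using (List; []; _∷_; _++_; length)
open import Data.Maybe.Base using (Maybe; just; nothing; fromMaybe)
import Data.Maybe.Base as Maybe
open import Data.Nat.Base using (ℕ; zero; suc; _≤_)
open import Data.Product.Base using (Σ-syntax; ∃-syntax; _×_; _,_; proj₁; proj₂)
open import Data.Sum.Base using (inj₁; inj₂)
open import Data.Sum.Relation.Binary.Pointwise using (_⊎ₛ_; inj₁; inj₂)
open import Function.Base using (_∘_)
open import Function.Bundles using (Inverse)
open import Level using (Level; 0ℓ; _⊔_) renaming (suc to lsuc)
open import Relation.Binary.Bundles using (Poset; Setoid)
open import Relation.Binary.Core using (Rel; _Preserves_⟶_; _Preserves₂_⟶_⟶_)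
open import Relation.Binary.Definitions using (_Respects_)
import Relation.Binary.Construct.On as On
open import Relation.Binary.Construct.Closure.ReflexiveTransitive using (Star)
open import Relation.Binary.Construct.Closure.Transitive using (TransClosure)
open import Relation.Binary.Lattice.Bundles using (BoundedJoinSemilattice)
open import Relation.Binary.PropositionalEquality
  using (_≡_; trans; cong; _→-setoid_)
import Relation.Binary.PropositionalEquality as ≡
open import Relation.Nullary.Negation.Core using (¬_)
open import Relation.Unary using (Pred; _∈_; _⊆_; _≐_; ∅)
open import Relation.Unary.Relation.Binary.Subset using (⊆-poset)

module Words (k : ℕ) where

  Letter : Set
  Letter = Fin k

  Word* : Set
  Word* = List Letter

  -- Finite (inj₁) and infinite (inj₂) words.  Functions are not
  -- extensional, so infinite words are compared letter by letter.
  wordSetoid : Setoid 0ℓ 0ℓ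
  wordSetoid = ≡.setoid Word* ⊎ₛ (ℕ →-setoid Letter)

  open Setoid wordSetoid public using () renaming (Carrier to Word; _≈_ to _≋_)

  prepend : Word* → (ℕ → Letter) → (ℕ → Letter)
  prepend []      f n       = f n
  prepend (a ∷ u) f zero    = a
  prepend (a ∷ u) f (suc n) = prepend u f n

  infixr 5 _◃_
  _◃_ : Word* → Word → Word
  u ◃ inj₁ v = inj₁ (u ++ v)
  u ◃ inj₂ f = inj₂ (prepend u f)

  nth : Word* → ℕ → Maybe Letter
  nth []      n       = nothing
  nth (a ∷ u) zero    = just a
  nth (a ∷ u) (suc n) = nth u n

  letterAt : Word → ℕ → Maybe Letter
  letterAt (inj₁ u) n = nth u n
  letterAt (inj₂ f) n = just (f n)

  letterAt-cong : ∀ {v w} → v ≋ w → ∀ n → letterAt v n ≡ letterAt w n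
  letterAt-cong (inj₁ u≡v) n = cong (λ u → nth u n) u≡v
  letterAt-cong (inj₂ f≗g) n = cong just (f≗g n)

  concatUpTo : (ℕ → Word*) → ℕ → Word*
  concatUpTo u zero    = []
  concatUpTo u (suc n) = concatUpTo u n ++ u n

  -- w = u₀u₁u₂⋯ : the partial products converge to w, position by
  -- position.  Past its end a word has the letter `nothing`, so w is
  -- finite exactly when all but finitely many uᵢ are empty.
  IsProduct : (ℕ → Word*) → Word → Set
  IsProduct u w =
    ∀ i → ∃[ N ] (∀ n → N ≤ n → nth (concatUpTo u n) i ≡ letterAt w i)

  Lang* : Set₁
  Lang* = Pred Word* 0ℓ

  -- Subsets of Σ^{≤ω} have to respect equality of words.
  record Lang≤ω : Set₁ where
    constructor lang
    field
      words    : Pred Word 0ℓ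
      respects : words Respects _≋_

  open Lang≤ω public

  infix 4 _∈ω_
  _∈ω_ : Word → Lang≤ω → Set
  w ∈ω V = w ∈ words V

  𝒫* : Poset (lsuc 0ℓ) 0ℓ 0ℓ
  𝒫* = ⊆-poset Word* 0ℓ

  𝒫≤ω : Poset (lsuc 0ℓ) 0ℓ 0ℓ
  𝒫≤ω = On.poset (⊆-poset Word 0ℓ) words

  infixr 7 _∙*_ _∙ω_
  infix  8 _^ω

  _∙*_ : Lang* → Lang* → Lang*
  (U ∙* V) w = ∃[ u ] ∃[ v ] (u ∈ U × v ∈ V × w ≡ u ++ v)

  _∙ω_ : Lang* → Lang≤ω → Lang≤ω
  U ∙ω V = lang
    (λ w → ∃[ u ] ∃[ v ] (u ∈ U × v ∈ω V × w ≋ u ◃ v))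
    (λ { w≋w′ (u , v , u∈U , v∈V , w≋uv) →
         u , v , u∈U , v∈V , S.trans (S.sym w≋w′) w≋uv })
    where module S = Setoid wordSetoid

  _^ω : Lang* → Lang≤ω
  U ^ω = lang
    (λ w → Σ[ u ∈ (ℕ → Word*) ] ((∀ i → u i ∈ U) × IsProduct u w))
    (λ { w≋w′ (u , u∈U , conv) → u , u∈U , λ i →
         let (N , stable) = conv i in
         N , λ n N≤n → trans (stable n N≤n) (letterAt-cong w≋w′ i) })

-- The part of a program that method signatures depend on.
record ClassTable : Set where
  field
    #Cls #Mtd #Lbl : ℕ

  Cls : Set
  Cls = Fin #Cls

  Mtd : Set
  Mtd = Fin #Mtd

  Lbl : Set
  Lbl = Fin #Lbl

  field
    superclass : Cls → Maybe Cls
    methods    : Cls → Subset.Subset #Mtd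
    -- number of arguments; only relevant for methods of the class
    arity      : Cls → Mtd → ℕ

  _≺_ : Rel Cls 0ℓ
  C ≺ D = superclass C ≡ just D

  _≼_ : Rel Cls 0ℓ
  _≼_ = Star _≺_

  field
    acyclic  : ∀ C → ¬ TransClosure _≺_ C C
    inherits : ∀ {C D} → C ≺ D → methods D Subset.⊆ methods C
    override : ∀ {C D m} → C ≺ D → m Subset.∈ methods D → arity C m ≡ arity D m

module Signatures (P : ClassTable) where
  open ClassTable P

  data Reg : Set where
    Null      : Reg
    CreatedAt : Lbl → Reg
    Unknown   : Reg

  record Sig : Set where
    constructor sig
    field
      cls       : Cls
      reg       : Reg
      mtd       : Mtd
      args      : List Reg
      .isMethod : mtd Subset.∈ methods cls
      .perArg   : length args ≡ arity cls mtd

-- Partial functions.  They are only used for the finite sets K = Reg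
-- and K = Sig, where every partial function is a finite one.
infix 9 _⟨_⟩
_⟨_⟩ : ∀ {a} → Set a → Set → Set a
A ⟨ K ⟩ = K → Maybe A

MethodTyping : ∀ {a} → ClassTable → Set a → Set a
MethodTyping P A = Sig → A ⟨ Reg ⟩ × A ⟨ Sig ⟩
  where open Signatures P

module _ (P : ClassTable) (k : ℕ) where
  open Signatures P
  open Words k

  Assignment : Set₁
  Assignment = Sig → Lang≤ω

  -- S(η) = ⋃ᵢ Uᵢ · η(δᵢ)
  evaluate : Lang* ⟨ Sig ⟩ → Assignment → Lang≤ω
  evaluate S η = lang
    (λ w → ∃[ δ ] (w ∈ω (fromMaybe ∅ (S δ) ∙ω η δ)))
    (λ { w≋w′ (δ , w∈) → δ , respects (fromMaybe ∅ (S δ) ∙ω η δ) w≋w′ w∈ })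

  IsSolution : MethodTyping P Lang* → Assignment → Set
  IsSolution M η = ∀ δ → words (η δ) ≐ words (evaluate (proj₂ (M δ)) η)

  record IsInfinitaryEffectTyping (M : MethodTyping P Lang*) (η : Assignment) : Set₁ where
    field
      isSolution : IsSolution M η
      isGreatest : ∀ η′ → IsSolution M η′ → ∀ δ → words (η′ δ) ⊆ words (η δ)

IsFinite : ∀ {a ℓ} → Setoid a ℓ → Set (a ⊔ ℓ)
IsFinite S = Σ[ n ∈ ℕ ] Inverse S (≡.setoid (Fin n))

-- Join-semilattices are taken with the empty join, since undefined
-- entries of expressions are read as the least element.  For a Büchi
-- abstraction this is no restriction: α(∅) is least.
record BüchiAlgebra : Set₁ where
  infixr 7 _∙_ _·_
  infix  8 _^ω
  field
    M*  : BoundedJoinSemilattice 0ℓ 0ℓ 0ℓ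
    M≤ω : BoundedJoinSemilattice 0ℓ 0ℓ 0ℓ

  module M*  = BoundedJoinSemilattice M*
  module M≤ω = BoundedJoinSemilattice M≤ω

  field
    _∙_     : M*.Carrier → M*.Carrier → M*.Carrier
    _·_     : M*.Carrier → M≤ω.Carrier → M≤ω.Carrier
    _^ω     : M*.Carrier → M≤ω.Carrier
    ∙-mono  : _∙_ Preserves₂ M*._≤_ ⟶ M*._≤_ ⟶ M*._≤_
    ·-mono  : _·_ Preserves₂ M*._≤_ ⟶ M≤ω._≤_ ⟶ M≤ω._≤_
    ^ω-mono : _^ω Preserves M*._≤_ ⟶ M≤ω._≤_
    ∙-assoc : ∀ a b c → (a ∙ (b ∙ c)) M*.≈ ((a ∙ b) ∙ c)
    ·-assoc : ∀ a b u → (a · (b · u)) M≤ω.≈ ((a ∙ b) · u)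

record FiniteBüchiAlgebra : Set₁ where
  field
    algebra : BüchiAlgebra
  open BüchiAlgebra algebra public
  field
    M*-finite  : IsFinite (Poset.Eq.setoid M*.poset)
    M≤ω-finite : IsFinite (Poset.Eq.setoid M≤ω.poset)

record GaloisInsertion {a₁ a₂ a₃ c₁ c₂ c₃ : Level}
                       (A : Poset a₁ a₂ a₃) (C : Poset c₁ c₂ c₃)
                       : Set (a₁ ⊔ a₂ ⊔ a₃ ⊔ c₁ ⊔ c₂ ⊔ c₃) where
  private
    module A = Poset A
    module C = Poset C
  field
    α      : C.Carrier → A.Carrier
    γ      : A.Carrier → C.Carrier
    α-mono : α Preserves C._≤_ ⟶ A._≤_
    γ-mono : γ Preserves A._≤_ ⟶ C._≤_
    α∘γ    : ∀ a → α (γ a) A.≈ a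
    γ∘α    : ∀ c → c C.≤ γ (α c)

record BüchiAbstraction (k : ℕ) : Set₁ where
  private module W = Words k
  field
    finiteAlgebra : FiniteBüchiAlgebra
  open FiniteBüchiAlgebra finiteAlgebra public
  field
    insertion*  : GaloisInsertion M*.poset W.𝒫*
    insertion≤ω : GaloisInsertion M≤ω.poset W.𝒫≤ω
  open GaloisInsertion insertion* public
    renaming (α to α*; γ to γ*; α-mono to α*-mono; γ-mono to γ*-mono;
              α∘γ to α*∘γ*; γ∘α to γ*∘α*)
  open GaloisInsertion insertion≤ω public
    renaming (α to α≤ω; γ to γ≤ω; α-mono to α≤ω-mono; γ-mono to γ≤ω-mono;
              α∘γ to α≤ω∘γ≤ω; γ∘α to γ≤ω∘α≤ω)
  field
    α*-∙   : ∀ U V → α* (U W.∙* V) M*.≈ (α* U ∙ α* V)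
    α≤ω-·  : ∀ U V → α≤ω (U W.∙ω V) M≤ω.≈ (α* U · α≤ω V)
    α≤ω-^ω : ∀ U → α≤ω (U W.^ω) M≤ω.≈ (α* U) ^ω

IsFaithful : ∀ {k} → BüchiAbstraction k → Words.Lang≤ω k → Set
IsFaithful {k} 𝓑 𝔄 = words (γ≤ω (α≤ω 𝔄)) ≐ words 𝔄
  where
  open BüchiAbstraction 𝓑
  open Words k

record BüchiMethodTyping (P : ClassTable) (𝓜 : FiniteBüchiAlgebra) : Set where
  open ClassTable P using (_≼_)
  open Signatures P
  open FiniteBüchiAlgebra 𝓜

  infix 4 _⊑_
  _⊑_ : ∀ {K} → M*.Carrier ⟨ K ⟩ → M*.Carrier ⟨ K ⟩ → Set
  𝒮 ⊑ 𝒯 = ∀ x → fromMaybe M*.⊥ (𝒮 x) M*.≤ fromMaybe M*.⊥ (𝒯 x)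

  field
    typing : MethodTyping P M*.Carrier
    mono   : ∀ (δ δ′ : Sig) → Sig.cls δ ≼ Sig.cls δ′ →
             Sig.reg δ ≡ Sig.reg δ′ → Sig.mtd δ ≡ Sig.mtd δ′ →
             Sig.args δ ≡ Sig.args δ′ →
             (proj₁ (typing δ) ⊑ proj₁ (typing δ′)) ×
             (proj₂ (typing δ) ⊑ proj₂ (typing δ′))

concretize : ∀ {P k} (𝓑 : BüchiAbstraction k) →
             BüchiMethodTyping P (BüchiAbstraction.finiteAlgebra 𝓑) →
             MethodTyping P (Words.Lang* k)
concretize 𝓑 M δ = Maybe.map γ* ∘ proj₁ (typing δ) , Maybe.map γ* ∘ proj₂ (typing δ)
  where
  open BüchiAbstraction 𝓑
  open BüchiMethodTyping M

-- A procedure computing an abstract assignment from the finite algebra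
-- and the Büchi method typing alone: the maps α and γ, which act on
-- arbitrary languages, are not among its inputs.
EffectProcedure : Set₁
EffectProcedure =
  (P : ClassTable) (𝓜 : FiniteBüchiAlgebra) → BüchiMethodTyping P 𝓜 →
  Signatures.Sig P → FiniteBüchiAlgebra.M≤ω.Carrier 𝓜

{-# OPTIONS --safe #-}
module Submission where

-- Read the equation system δ = ⋃ U(δ,δ′) · δ′ as a graph on the signatures
-- whose edges are labelled with languages, and let Path δ δ′ be the words
-- read along nonempty paths from δ to δ′.  The greatest solution is
--
--   η(δ) = ⋃_δ′ Path δ δ′ · T(δ′),
--   T(δ′) = Σ^{≤ω} if ε ∈ Path δ′ δ′, and (Path δ′ δ′)^ω otherwise.
--
-- The case distinction is forced: X = X has Σ^{≤ω} as greatest solution,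
-- not {ε}^ω, so a cycle that can be passed silently contributes every word.
-- The right-hand side is a solution because T(δ′) ⊆ Path δ′ δ′ · T(δ′).
-- It is the greatest one because unravelling the equations at a word of any
-- solution gives an infinite path, and some signature δ′ recurs on it.  The
-- word up to the first visit lies in Path δ δ′.  The rest lies in Σ^{≤ω}
-- anyway if δ′ has a silent cycle.  If not, each round from δ′ to δ′ reads
-- at least one letter, so the rest is the infinite product of the rounds.
--
-- It remains to compute the abstraction of this expression in the finite
-- algebra.  As α preserves the products and ω-power, only two facts about
-- languages have to be recovered from the algebra.
--
-- * α(Path δ δ′) is the join of the values of paths, the value of a path
--   being the product of its edge labels.  Only finitely many values exist,
--   and those attained form a reachability problem on the finite graph of
--   pairs (signature, value).  The join lies below α(Path δ δ′) as each
--   value does, and above it as each word lies in γ of some value.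
-- * ε ∈ γ(a) holds iff b ≤ a ∙ b for all b.  Indeed α({ε}) is a unit of the
--   algebra, and by adjunction ε ∈ γ(a) iff this unit is below a.  Silent
--   cycles are therefore cycles in another decidable finite graph.

open import Defs
open import Data.Bool.Base using (if_then_else_; true; false)
open import Data.Empty using (⊥)
open import Data.Fin.Base using (Fin)
import Data.Fin.Properties as Fin
import Data.Fin.Subset as Subset
import Data.Fin.Subset.Properties as Subset
open import Data.List.Base
  using (List; []; _∷_; _++_; length; drop; map; filter; foldr; concatMap;
         cartesianProduct; cartesianProductWith; allFin)
open import Data.List.Membership.Propositional using (lose) renaming (_∈_ to _∈ˡ_)
open import Data.List.Membership.Propositional.Properties
  using (∈-allFin; ∈-map⁺; ∈-filter⁺; ∈-concatMap⁺; ∈-cartesianProduct⁺;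
         ∈-cartesianProductWith⁺)
open import Data.List.Properties using (++-assoc; ++-identityʳ; length-++)
open import Data.List.Relation.Unary.All using (All; []; _∷_)
import Data.List.Relation.Unary.All as All
import Data.List.Relation.Unary.All.Properties as All
open import Data.List.Relation.Unary.Any using (here; there)
open import Data.Maybe.Base using (Maybe; just; nothing; fromMaybe)
import Data.Maybe.Base as Maybe
import Data.Maybe.Properties as Maybe
open import Data.Maybe.Relation.Unary.Any using (just) renaming (Any to AnyMaybe)
import Data.Maybe.Relation.Unary.Any as AnyMaybe
open import Data.Nat.Base
  using (ℕ; zero; suc; _+_; _⊔_; _≤_; _<_; z≤n; s≤s; _<′_; ≤′-reflexive; ≤′-step)
import Data.Nat.Properties as ℕ
open import Data.Product.Base using (Σ-syntax; ∃-syntax; _×_; _,_; proj₁; proj₂)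
open import Data.Sum.Base using (_⊎_; inj₁; inj₂)
open import Data.Sum.Relation.Binary.Pointwise using (inj₁; inj₂)
open import Data.Unit.Base using (⊤; tt)
open import Function.Base using (_∘_)
open import Function.Bundles using (Inverse)
open import Function.Properties.Inverse using (Inverse⇒Injection)
open import Level using (0ℓ)
open import Relation.Binary.Bundles using (Poset; Setoid)
open import Relation.Binary.Core using (Rel)
open import Relation.Binary.Definitions using (Decidable)
open import Relation.Binary.Construct.Closure.Transitive using (TransClosure; [_]; _∷_; transitive)
open import Relation.Binary.Lattice.Bundles using (BoundedJoinSemilattice)
import Relation.Binary.Lattice.Properties.JoinSemilattice as JoinSemilatticeProperties
open import Relation.Binary.PropositionalEquality
  using (_≡_; refl; sym; trans; cong; cong₂; subst; subst₂; module ≡-Reasoning)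
open import Relation.Nullary using (¬_; Dec; yes; no; does; _×-dec_; _⊎-dec_)
open import Relation.Nullary.Decidable using (map′; recompute; via-injection)
open import Relation.Nullary.Negation.Core using (contradiction; contradiction-irr)
open import Relation.Unary using (Pred; _∈_; _⊆_; ∅)
import Relation.Unary as Unary

-- Decidability of reachability in a finite graph.

module Reachability {A : Set} {_∼_ : Rel A 0ℓ} (_∼?_ : Decidable _∼_) where

  -- Warshall's recursion: a path through at most the intermediate nodes
  -- z ∷ zs avoids z, or splits at z into two paths that do.
  Via : List A → Rel A 0ℓ
  Via []       x y = x ∼ y
  Via (z ∷ zs) x y = Via zs x y ⊎ (Via zs x z × Via zs z y)

  via? : ∀ zs → Decidable (Via zs)
  via? []       x y = x ∼? y
  via? (z ∷ zs) x y = via? zs x y ⊎-dec (via? zs x z ×-dec via? zs z y)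

  edge : ∀ zs {x y} → x ∼ y → Via zs x y
  edge []       r = r
  edge (z ∷ zs) r = inj₁ (edge zs r)

  to-new : ∀ {z} zs {x} → Via (z ∷ zs) x z → Via zs x z
  to-new zs (inj₁ p)       = p
  to-new zs (inj₂ (p , _)) = p

  from-new : ∀ {z} zs {y} → Via (z ∷ zs) z y → Via zs z y
  from-new zs (inj₁ p)       = p
  from-new zs (inj₂ (_ , p)) = p

  -- Once all nodes are admitted, this makes Via transitive.  In every case
  -- at most one visit to the head of the list has to be kept.
  join : ∀ {z} zs {x y} → z ∈ˡ zs → Via zs x z → Via zs z y → Via zs x y
  join (_ ∷ zs) (here refl) p q = inj₂ (to-new zs p , from-new zs q)
  join (_ ∷ zs) (there z∈) (inj₁ p)        (inj₁ q)        = inj₁ (join zs z∈ p q)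
  join (_ ∷ zs) (there z∈) (inj₁ p)        (inj₂ (q , q′)) = inj₂ (join zs z∈ p q , q′)
  join (_ ∷ zs) (there z∈) (inj₂ (p , p′)) (inj₁ q)        = inj₂ (p , join zs z∈ p′ q)
  join (_ ∷ zs) (there z∈) (inj₂ (p , _))  (inj₂ (_ , q))  = inj₂ (p , q)

  via⇒closure : ∀ zs {x y} → Via zs x y → TransClosure _∼_ x y
  via⇒closure []       r              = [ r ]
  via⇒closure (z ∷ zs) (inj₁ p)       = via⇒closure zs p
  via⇒closure (z ∷ zs) (inj₂ (p , q)) = transitive _∼_ (via⇒closure zs p) (via⇒closure zs q)

  closure? : ∀ zs → (∀ x → x ∈ˡ zs) → Decidable (TransClosure _∼_)
  closure? zs all∈ x y = map′ (via⇒closure zs) closure⇒via (via? zs x y)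
    where
    closure⇒via : ∀ {x y} → TransClosure _∼_ x y → Via zs x y
    closure⇒via [ r ]              = edge zs r
    closure⇒via (_∷_ {y = y} r rs) = join zs (all∈ y) (edge zs r) (closure⇒via rs)

-- Finiteness of the set of signatures.

module SignatureEnumeration (P : ClassTable) where
  open ClassTable P
  open Signatures P

  regions : List Reg
  regions = Null ∷ Unknown ∷ map CreatedAt (allFin #Lbl)

  ∈-regions : ∀ r → r ∈ˡ regions
  ∈-regions Null          = here refl
  ∈-regions Unknown       = there (here refl)
  ∈-regions (CreatedAt ℓ) = there (there (∈-map⁺ CreatedAt (∈-allFin ℓ)))

  tuples : ℕ → List (List Reg)
  tuples zero    = [] ∷ []
  tuples (suc n) = cartesianProductWith _∷_ regions (tuples n)

  ∈-tuples : ∀ s → s ∈ˡ tuples (length s)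
  ∈-tuples []      = here refl
  ∈-tuples (r ∷ s) = ∈-cartesianProductWith⁺ _∷_ (∈-regions r) (∈-tuples s)

  signature : Cls → Mtd → Reg → List Reg → List Sig
  signature C m r s with m Subset.∈? methods C ×-dec (length s ℕ.≟ arity C m)
  ... | yes (m∈C , perArg) = sig C r m s m∈C perArg ∷ []
  ... | no  _              = []

  -- The two proofs in a signature are irrelevant, so any signature with these
  -- components is equal to the one that the decision procedure builds.
  ∈-signature : ∀ C m r s .(m∈C : m Subset.∈ methods C) .(perArg : length s ≡ arity C m) →
                sig C r m s m∈C perArg ∈ˡ signature C m r s
  ∈-signature C m r s m∈C perArg with m Subset.∈? methods C ×-dec (length s ℕ.≟ arity C m)
  ... | yes _   = here refl
  ... | no  ¬ok = contradiction-irr (m∈C , perArg) ¬ok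

  ofRegion : Cls → Mtd → Reg → List Sig
  ofRegion C m r = concatMap (signature C m r) (tuples (arity C m))

  ofMethod : Cls → Mtd → List Sig
  ofMethod C m = concatMap (ofRegion C m) regions

  ofClass : Cls → List Sig
  ofClass C = concatMap (ofMethod C) (allFin #Mtd)

  signatures : List Sig
  signatures = concatMap ofClass (allFin #Cls)

  ∈-signatures : ∀ δ → δ ∈ˡ signatures
  ∈-signatures (sig C r m s m∈C perArg) =
    bind ofClass (∈-allFin C)
      (bind (ofMethod C) (∈-allFin m)
        (bind (ofRegion C m) (∈-regions r)
          (bind (signature C m r) s∈ (∈-signature C m r s m∈C perArg))))
    where
    bind : ∀ {A B : Set} (f : A → List B) {x xs y} → x ∈ˡ xs → y ∈ˡ f x → y ∈ˡ concatMap f xs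
    bind f x∈xs y∈fx = ∈-concatMap⁺ f (lose x∈xs y∈fx)

    -- The arity proof is irrelevant, and is recomputed before it is used to
    -- transport.
    s∈ : s ∈ˡ tuples (arity C m)
    s∈ = subst (λ n → s ∈ˡ tuples n) (recompute (length s ℕ.≟ arity C m) perArg) (∈-tuples s)

-- Joins in finite semilattices.

module Joins (L : BoundedJoinSemilattice 0ℓ 0ℓ 0ℓ) where
  open BoundedJoinSemilattice L renaming (_≤_ to _⊑_; trans to ⊑-trans; ⊥ to least)

  ⋁ : List Carrier → Carrier
  ⋁ = foldr _∨_ least

  ⋁-upper : ∀ {x xs} → x ∈ˡ xs → x ⊑ ⋁ xs
  ⋁-upper {xs = y ∷ xs} (here refl)  = x≤x∨y y (⋁ xs)
  ⋁-upper {xs = y ∷ xs} (there x∈xs) = ⊑-trans (⋁-upper x∈xs) (y≤x∨y y (⋁ xs))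

  ⋁-least : ∀ {b xs} → All (_⊑ b) xs → ⋁ xs ⊑ b
  ⋁-least {b} []       = minimum b
  ⋁-least (x⊑b ∷ xs⊑b) = ∨-least x⊑b (⋁-least xs⊑b)

module FiniteJoins (L : BoundedJoinSemilattice 0ℓ 0ℓ 0ℓ)
                   (finite : IsFinite (Poset.Eq.setoid (BoundedJoinSemilattice.poset L))) where
  open BoundedJoinSemilattice L renaming (_≤_ to _⊑_; trans to ⊑-trans)
  open Joins L public

  size : ℕ
  size = proj₁ finite

  index : Carrier → Fin size
  index = Inverse.to (proj₂ finite)

  elem : Fin size → Carrier
  elem = Inverse.from (proj₂ finite)

  elem-index : ∀ x → elem (index x) ≈ x
  elem-index = Inverse.strictlyInverseʳ (proj₂ finite)

  _⊑?_ : Decidable _⊑_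
  _⊑?_ = JoinSemilatticeProperties.≈-dec⇒≤-dec joinSemilattice
    (via-injection (Inverse⇒Injection (proj₂ finite)) Fin._≟_)

  ⋁[_] : {P : Pred (Fin size) 0ℓ} → Unary.Decidable P → Carrier
  ⋁[ P? ] = ⋁ (map elem (filter P? (allFin size)))

  module _ {P : Pred (Fin size) 0ℓ} (P? : Unary.Decidable P) where

    ⋁[]-upper : ∀ {i} → P i → elem i ⊑ ⋁[ P? ]
    ⋁[]-upper {i} Pi = ⋁-upper (∈-map⁺ elem (∈-filter⁺ P? (∈-allFin i) Pi))

    ⋁[]-least : ∀ {b} → (∀ {i} → P i → elem i ⊑ b) → ⋁[ P? ] ⊑ b
    ⋁[]-least below = ⋁-least (All.map⁺ (All.map below (All.all-filter P? (allFin size))))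

  greatest : Carrier
  greatest = ⋁ (map elem (allFin size))

  ⊑-greatest : ∀ x → x ⊑ greatest
  ⊑-greatest x = ⊑-trans (reflexive (Eq.sym (elem-index x)))
    (⋁-upper (∈-map⁺ elem (∈-allFin (index x))))

-- The abstract effect.

module Procedure (P : ClassTable) (𝓜 : FiniteBüchiAlgebra) (M : BüchiMethodTyping P 𝓜) where
  open Signatures P
  open SignatureEnumeration P
  open FiniteBüchiAlgebra 𝓜
  open BüchiMethodTyping M using (typing)
  private
    module F* = FiniteJoins M* M*-finite
    module Fω = FiniteJoins M≤ω M≤ω-finite

  coefficient : Sig → Sig → Maybe M*.Carrier
  coefficient δ = proj₂ (typing δ)

  -- A signature together with the value of the remaining path.  The empty path
  -- has the formal value nothing, since the algebra comes without a unit.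
  Node : Set
  Node = Sig × Maybe (Fin F*.size)

  _∙?_ : M*.Carrier → Maybe (Fin F*.size) → M*.Carrier
  a ∙? nothing = a
  a ∙? just i  = a ∙ F*.elem i

  -- Steps run from the value of a path to the value of its tail: the first
  -- coefficient times the tail's value must give the value of the path.
  Step : Rel Node 0ℓ
  Step (δ , nothing) _        = ⊥
  Step (δ , just i)  (δ′ , x) = AnyMaybe (λ a → i ≡ F*.index (a ∙? x)) (coefficient δ δ′)

  step? : Decidable Step
  step? (δ , nothing) _        = no λ ()
  step? (δ , just i)  (δ′ , x) =
    AnyMaybe.dec (λ a → i Fin.≟ F*.index (a ∙? x)) (coefficient δ δ′)

  PathValue : Sig → Sig → Pred (Fin F*.size) 0ℓ
  PathValue δ δ′ i = TransClosure Step (δ , just i) (δ′ , nothing)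

  pathValue? : ∀ δ δ′ → Unary.Decidable (PathValue δ δ′)
  pathValue? δ δ′ i = Reachability.closure? step? nodes ∈-nodes _ _
    where
    values : List (Maybe (Fin F*.size))
    values = nothing ∷ map just (allFin F*.size)

    nodes : List Node
    nodes = cartesianProduct signatures values

    ∈-values : ∀ x → x ∈ˡ values
    ∈-values nothing  = here refl
    ∈-values (just i) = there (∈-map⁺ just (∈-allFin i))

    ∈-nodes : ∀ ν → ν ∈ˡ nodes
    ∈-nodes (δ , x) = ∈-cartesianProduct⁺ (∈-signatures δ) (∈-values x)

  pathEffect : Sig → Sig → M*.Carrier
  pathEffect δ δ′ = F*.⋁[ pathValue? δ δ′ ]

  -- A test for ε ∈ γ(a) in terms of the algebra alone.  For a Büchi
  -- abstraction α({ε}) is a unit, and the elements above a unit are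
  -- exactly those satisfying this inequality.
  AboveUnit : Pred M*.Carrier 0ℓ
  AboveUnit a = ∀ i → F*.elem i M*.≤ (a ∙ F*.elem i)

  SilentStep : Rel Sig 0ℓ
  SilentStep δ δ′ = AnyMaybe AboveUnit (coefficient δ δ′)

  silentCycle? : ∀ δ → Dec (TransClosure SilentStep δ δ)
  silentCycle? δ = Reachability.closure? silentStep? signatures ∈-signatures δ δ
    where
    silentStep? : Decidable SilentStep
    silentStep? δ δ′ = AnyMaybe.dec
      (λ a → Fin.all? (λ i → F*.elem i F*.⊑? (a ∙ F*.elem i))) (coefficient δ δ′)

  -- A silent cycle at δ lets every word be a tail at δ, and the abstraction of
  -- the language of all words is the greatest element.
  loopEffect : Sig → M≤ω.Carrier
  loopEffect δ = if does (silentCycle? δ) then Fω.greatest else pathEffect δ δ ^ω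

  effect : Sig → M≤ω.Carrier
  effect δ = Fω.⋁ (map (λ δ′ → pathEffect δ δ′ · loopEffect δ′) signatures)

-- Words and their infinite products.

module WordProperties (k : ℕ) where
  open Words k
  private module ≋ = Setoid wordSetoid

  ◃-identityˡ : ∀ w → w ≋ [] ◃ w
  ◃-identityˡ (inj₁ v) = inj₁ refl
  ◃-identityˡ (inj₂ f) = inj₂ λ _ → refl

  ◃-congʳ : ∀ u {v w} → v ≋ w → u ◃ v ≋ u ◃ w
  ◃-congʳ u (inj₁ v≡w) = inj₁ (cong (u ++_) v≡w)
  ◃-congʳ u (inj₂ f≗g) = inj₂ (prepend-cong u)
    where
    prepend-cong : ∀ u i → prepend u _ i ≡ prepend u _ i
    prepend-cong []      i       = f≗g i
    prepend-cong (a ∷ u) zero    = refl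
    prepend-cong (a ∷ u) (suc i) = prepend-cong u i

  ◃-assoc : ∀ u v w → (u ++ v) ◃ w ≋ u ◃ (v ◃ w)
  ◃-assoc u v (inj₁ w) = inj₁ (++-assoc u v w)
  ◃-assoc u v (inj₂ f) = inj₂ (prepend-++ u)
    where
    prepend-++ : ∀ u i → prepend (u ++ v) f i ≡ prepend u (prepend v f) i
    prepend-++ []      i       = refl
    prepend-++ (a ∷ u) zero    = refl
    prepend-++ (a ∷ u) (suc i) = prepend-++ u i

  ≋-◃-trans : ∀ {u v w₀ w₁ w₂} → w₀ ≋ u ◃ w₁ → w₁ ≋ v ◃ w₂ → w₀ ≋ (u ++ v) ◃ w₂
  ≋-◃-trans {u} {v} {w₂ = w₂} p q =
    ≋.trans p (≋.trans (◃-congʳ u q) (≋.sym (◃-assoc u v w₂)))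

  letterAt-prefix : ∀ u w {i} → i < length u → letterAt (u ◃ w) i ≡ nth u i
  letterAt-prefix (a ∷ u) (inj₁ v) {zero}  _       = refl
  letterAt-prefix (a ∷ u) (inj₂ f) {zero}  _       = refl
  letterAt-prefix (a ∷ u) (inj₁ v) {suc i} (s≤s l) = letterAt-prefix u (inj₁ v) l
  letterAt-prefix (a ∷ u) (inj₂ f) {suc i} (s≤s l) = letterAt-prefix u (inj₂ f) l

  letterAt-suffix : ∀ u w i → letterAt (u ◃ w) (length u + i) ≡ letterAt w i
  letterAt-suffix []      (inj₁ v) i = refl
  letterAt-suffix []      (inj₂ f) i = refl
  letterAt-suffix (a ∷ u) (inj₁ v) i = letterAt-suffix u (inj₁ v) i
  letterAt-suffix (a ∷ u) (inj₂ f) i = letterAt-suffix u (inj₂ f) i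

  nth-length : ∀ u → nth u (length u) ≡ nothing
  nth-length []      = refl
  nth-length (a ∷ u) = nth-length u

  nth-injective : ∀ u v → (∀ i → nth u i ≡ nth v i) → u ≡ v
  nth-injective []      []      eq = refl
  nth-injective []      (b ∷ v) eq = contradiction (eq 0) λ ()
  nth-injective (a ∷ u) []      eq = contradiction (eq 0) λ ()
  nth-injective (a ∷ u) (b ∷ v) eq =
    cong₂ _∷_ (Maybe.just-injective (eq 0)) (nth-injective u v (eq ∘ suc))

  -- A finite word differs from an infinite one at the position just past its
  -- end.
  letterAt-injective : ∀ v w → (∀ i → letterAt v i ≡ letterAt w i) → v ≋ w
  letterAt-injective (inj₁ u) (inj₁ v) eq = inj₁ (nth-injective u v eq)
  letterAt-injective (inj₂ f) (inj₂ g) eq = inj₂ (Maybe.just-injective ∘ eq)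
  letterAt-injective (inj₁ u) (inj₂ g) eq =
    contradiction (trans (sym (nth-length u)) (eq (length u))) λ ()
  letterAt-injective (inj₂ f) (inj₁ v) eq =
    contradiction (trans (eq (length v)) (nth-length v)) λ ()

  dropLetters : ℕ → Word → Word
  dropLetters n (inj₁ u) = inj₁ (drop n u)
  dropLetters n (inj₂ f) = inj₂ (f ∘ (n +_))

  letterAt-drop : ∀ n w i → letterAt (dropLetters n w) i ≡ letterAt w (n + i)
  letterAt-drop n       (inj₂ f)       i = refl
  letterAt-drop zero    (inj₁ u)       i = refl
  letterAt-drop (suc n) (inj₁ [])      i = refl
  letterAt-drop (suc n) (inj₁ (a ∷ u)) i = letterAt-drop n (inj₁ u) i

  concatUpTo-suc : ∀ u n → concatUpTo u (suc n) ≡ u 0 ++ concatUpTo (u ∘ suc) n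
  concatUpTo-suc u zero    = sym (++-identityʳ (u 0))
  concatUpTo-suc u (suc n) = begin
    concatUpTo u (suc n) ++ u (suc n)                ≡⟨ cong (_++ u (suc n)) (concatUpTo-suc u n) ⟩
    (u 0 ++ concatUpTo (u ∘ suc) n) ++ u (suc n)     ≡⟨ ++-assoc (u 0) _ _ ⟩
    u 0 ++ concatUpTo (u ∘ suc) n ++ u (suc n)       ∎
    where open ≡-Reasoning

  -- The tail of a product is obtained by deleting the letters of the first
  -- factor.  That it is the product of the remaining factors, and that
  -- prepending the first factor gives the word back, is checked letter by
  -- letter.
  ^ω-unfold : ∀ U → words (U ^ω) ⊆ words (U ∙ω U ^ω)
  ^ω-unfold U {w} (u , u∈U , converges) =
    u 0 , rest , u∈U 0 , (u ∘ suc , u∈U ∘ suc , converges′) ,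
    letterAt-injective w (u 0 ◃ rest) same
    where
    open ≡-Reasoning
    ℓ = length (u 0)
    rest = dropLetters ℓ w

    converges′ : IsProduct (u ∘ suc) rest
    converges′ i = let (N , stable) = converges (ℓ + i) in N , λ n N≤n → begin
      nth (concatUpTo (u ∘ suc) n) i                ≡⟨ letterAt-suffix (u 0) (inj₁ (concatUpTo (u ∘ suc) n)) i ⟨
      nth (u 0 ++ concatUpTo (u ∘ suc) n) (ℓ + i)   ≡⟨ cong (λ v → nth v (ℓ + i)) (concatUpTo-suc u n) ⟨
      nth (concatUpTo u (suc n)) (ℓ + i)            ≡⟨ stable (suc n) (ℕ.m≤n⇒m≤1+n N≤n) ⟩
      letterAt w (ℓ + i)                            ≡⟨ letterAt-drop ℓ w i ⟨
      letterAt rest i                               ∎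

    same : ∀ i → letterAt w i ≡ letterAt (u 0 ◃ rest) i
    same i with ℕ.≤-<-connex ℓ i
    ... | inj₁ ℓ≤i = subst (λ j → letterAt w j ≡ letterAt (u 0 ◃ rest) j) (ℕ.m+[n∸m]≡n ℓ≤i)
                       (trans (sym (letterAt-drop ℓ w _)) (sym (letterAt-suffix (u 0) rest _)))
    ... | inj₂ i<ℓ = let (N , stable) = converges i in begin
      letterAt w i                                 ≡⟨ stable (suc N) (ℕ.n≤1+n N) ⟨
      nth (concatUpTo u (suc N)) i                 ≡⟨ cong (λ v → nth v i) (concatUpTo-suc u N) ⟩
      nth (u 0 ++ concatUpTo (u ∘ suc) N) i        ≡⟨ letterAt-prefix (u 0) (inj₁ (concatUpTo (u ∘ suc) N)) i<ℓ ⟩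
      nth (u 0) i                                  ≡⟨ letterAt-prefix (u 0) rest i<ℓ ⟨
      letterAt (u 0 ◃ rest) i                      ∎

  -- After n nonempty factors at least n letters are fixed, so position i is
  -- final from stage i + 1 on.  If all factors were empty, w 0 could be any
  -- word while the product is empty.
  factors⇒product : (u : ℕ → Word*) (w : ℕ → Word) → (∀ n → w n ≋ u n ◃ w (suc n)) →
                    (∀ n → ¬ u n ≡ []) → IsProduct u (w 0)
  factors⇒product u w split nonempty i = suc i , λ n i<n →
    trans (sym (letterAt-prefix (concatUpTo u n) (w n) (ℕ.≤-trans i<n (long n))))
          (sym (letterAt-cong (prefix n) i))
    where
    prefix : ∀ n → w 0 ≋ concatUpTo u n ◃ w n
    prefix zero    = ◃-identityˡ (w 0)
    prefix (suc n) = ≋-◃-trans {concatUpTo u n} {u n} (prefix n) (split n)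

    1≤length : ∀ (v : Word*) → ¬ v ≡ [] → 1 ≤ length v
    1≤length []      v≢[] = contradiction refl v≢[]
    1≤length (_ ∷ _) _    = s≤s z≤n

    long : ∀ n → n ≤ length (concatUpTo u n)
    long zero    = z≤n
    long (suc n) = subst₂ _≤_ (ℕ.+-comm n 1) (sym (length-++ (concatUpTo u n)))
                     (ℕ.+-mono-≤ (long n) (1≤length (u n) (nonempty n)))

-- Recurrent values of a sequence.

module Recurrence (em : ExcludedMiddle 0ℓ) {K : Set} where

  Recurs : (ℕ → K) → Pred K 0ℓ
  Recurs f x = ∀ n → ∃[ m ] (n < m × f m ≡ x)

  -- Pigeonhole for infinite sequences: an element that does not recur is absent
  -- from some point on and can be dropped from the list of candidates.
  recurs : ∀ (f : ℕ → K) xs N → (∀ n → N < n → f n ∈ˡ xs) → ∃[ x ] Recurs f x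
  recurs f []       N late = contradiction (late (suc N) ℕ.≤-refl) λ ()
  recurs f (x ∷ xs) N late with em {P = Recurs f x}
  ... | yes often = x , often
  ... | no  ¬often with em {P = ∃[ n ] (∀ m → n < m → ¬ f m ≡ x)}
  ...   | no  ¬seldom = contradiction often ¬often
    where
    often : Recurs f x
    often n with em {P = ∃[ m ] (n < m × f m ≡ x)}
    ... | yes found = found
    ... | no  ¬found = contradiction (n , λ m n<m fm≡x → ¬found (m , n<m , fm≡x)) ¬seldom
  ...   | yes (n , never) = recurs f xs (N ⊔ n) late′
    where
    late′ : ∀ m → N ⊔ n < m → f m ∈ˡ xs
    late′ m lt with late m (ℕ.m⊔n<o⇒m<o N n lt)
    ... | here fm≡x = contradiction fm≡x (never m (ℕ.m⊔n<o⇒n<o N n lt))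
    ... | there f∈  = f∈

-- The greatest solution of a system of language equations.

module EquationSystem (k : ℕ) {K : Set} (U : K → K → Words.Lang* k) where
  open Words k
  open WordProperties k
  private module ≋ = Setoid wordSetoid

  -- The words read along nonempty paths.  The product is an explicit equation
  -- so that paths reading the empty word can be analysed.
  data Path : K → K → Lang* where
    last : ∀ {x y u} → u ∈ U x y → u ∈ Path x y
    step : ∀ {x y z u v w} → u ∈ U x y → v ∈ Path y z → w ≡ u ++ v → w ∈ Path x z

  snoc : ∀ {x y z u v} → u ∈ Path x y → v ∈ U y z → (u ++ v) ∈ Path x z
  snoc (last u∈) v∈ = step u∈ (last v∈) refl
  snoc {v = v} (step {u = u₀} {v = u₁} u∈ p refl) v∈ = step u∈ (snoc p v∈) (++-assoc u₀ u₁ v)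

  rhs : (K → Lang≤ω) → K → Pred Word 0ℓ
  rhs η x w = ∃[ y ] (w ∈ω (U x y ∙ω η y))

  full : Lang≤ω
  full = lang (λ _ → ⊤) (λ _ _ → tt)

  module GreatestSolution (silent? : ∀ x → Dec ([] ∈ Path x x)) where

    -- The words that can be read along infinite paths returning to x again and
    -- again.  If such paths can remain silent, they put no constraint on the word
    -- that is left over, which may then be any word.
    loops : K → Lang≤ω
    loops x = if does (silent? x) then full else Path x x ^ω

    solution : K → Pred Word 0ℓ
    solution x w = ∃[ y ] (w ∈ω (Path x y ∙ω loops y))

    loops-unfold : ∀ x → words (loops x) ⊆ words (Path x x ∙ω loops x)
    loops-unfold x {w} w∈ with silent? x
    ... | yes []∈ = [] , w , []∈ , tt , ◃-identityˡ w
    ... | no  _   = ^ω-unfold (Path x x) w∈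

    solution-respects : ∀ x {v w} → v ≋ w → solution x v → solution x w
    solution-respects x v≋w (y , v∈) = y , respects (Path x y ∙ω loops y) v≋w v∈

    solutionω : K → Lang≤ω
    solutionω x = lang (solution x) (solution-respects x)

    -- When the path to z consists of a single edge, this edge uses it up, and
    -- another round at z has to be split off the tail.
    solution⊆rhs : ∀ x → solution x ⊆ rhs solutionω x
    solution⊆rhs x (y , u , w , last u∈ , w∈ , eq) =
      y , u , w , u∈ , (y , loops-unfold y w∈) , eq
    solution⊆rhs x (z , _ , w , step {y = y} {u = u} {v = v} u∈ p refl , w∈ , eq) =
      y , u , (v ◃ w) , u∈ , (z , v , w , p , w∈ , ≋.refl) , ≋.trans eq (◃-assoc u v w)

    rhs⊆solution : ∀ x → rhs solutionω x ⊆ solution x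
    rhs⊆solution x (y , u , w₁ , u∈ , (z , v , w₂ , p , w₂∈ , eq₁) , eq) =
      z , u ++ v , w₂ , step u∈ p refl , w₂∈ , ≋-◃-trans {u} {v} eq eq₁

    module _ (em : ExcludedMiddle 0ℓ) (xs : List K) (∈-xs : ∀ x → x ∈ˡ xs)
             (η : K → Lang≤ω) (η⊆rhs : ∀ x → words (η x) ⊆ rhs η x) where
      open Recurrence em {K}

      private
        -- A node and a word in its language: each equation splits a factor off the
        -- word and moves to a successor node.
        State : Set
        State = Σ[ x ∈ K ] Σ[ w ∈ Word ] (w ∈ω η x)

        next : State → State
        next (x , w , w∈) = let (y , u , w′ , u∈ , w′∈ , eq) = η⊆rhs x w∈ in y , w′ , w′∈

      module Unravelling (start : State) where

        run : ℕ → State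
        run zero    = start
        run (suc n) = next (run n)

        node : ℕ → K
        node n = proj₁ (run n)

        word : ℕ → Word
        word n = proj₁ (proj₂ (run n))

        segment : ∀ {m n} → m <′ n →
                  ∃[ u ] (u ∈ Path (node m) (node n) × word m ≋ u ◃ word n)
        segment {m} (≤′-reflexive refl) =
          let (y , u , w′ , u∈ , w′∈ , eq) = η⊆rhs (node m) (proj₂ (proj₂ (run m))) in
          u , last u∈ , eq
        segment (≤′-step {n} m<n) =
          let (v , v∈ , eq₀) = segment m<n
              (y , u , w′ , u∈ , w′∈ , eq) = η⊆rhs (node n) (proj₂ (proj₂ (run n)))
          in v ++ u , snoc v∈ u∈ , ≋-◃-trans {v} {u} eq₀ eq

        module _ {x : K} (often : Recurs node x) where

          -- Positions of successive visits to x.  The first is positive, so that the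
          -- path leading to it is nonempty.
          visit : ℕ → ℕ
          visit zero    = proj₁ (often 0)
          visit (suc j) = proj₁ (often (visit j))

          node-visit : ∀ j → node (visit j) ≡ x
          node-visit zero    = proj₂ (proj₂ (often 0))
          node-visit (suc j) = proj₂ (proj₂ (often (visit j)))

          loop : ∀ j → ∃[ u ] (u ∈ Path (node (visit j)) (node (visit (suc j))) ×
                               word (visit j) ≋ u ◃ word (visit (suc j)))
          loop j = segment (ℕ.≤⇒≤′ (proj₁ (proj₂ (often (visit j)))))

          loop∈ : ∀ j → proj₁ (loop j) ∈ Path x x
          loop∈ j = subst₂ (λ y z → proj₁ (loop j) ∈ Path y z)
                      (node-visit j) (node-visit (suc j)) (proj₁ (proj₂ (loop j)))

          -- Without a silent cycle at x no round is empty, which is what makes the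
          -- rounds' product converge to the whole remaining word.
          word∈loops : word (visit 0) ∈ω loops x
          word∈loops with silent? x
          ... | yes _   = tt
          ... | no  []∉ = proj₁ ∘ loop , loop∈ ,
            factors⇒product (proj₁ ∘ loop) (word ∘ visit) (proj₂ ∘ proj₂ ∘ loop)
              (λ j empty → []∉ (subst (_∈ Path x x) empty (loop∈ j)))

          start∈solution : solution (node 0) (word 0)
          start∈solution =
            let (u , u∈ , eq) = segment (ℕ.≤⇒≤′ (proj₁ (proj₂ (often 0)))) in
            x , u , word (visit 0) ,
            subst (λ y → u ∈ Path (node 0) y) (node-visit 0) u∈ , word∈loops , eq

      ⊆solution : ∀ x → words (η x) ⊆ solution x
      ⊆solution x {w} w∈ = start∈solution (proj₂ (recurs node xs 0 (λ n _ → ∈-xs (node n))))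
        where open Unravelling (x , w , w∈)

-- Abstraction of the greatest solution.

module Correctness (k : ℕ) (𝓑 : BüchiAbstraction k) (P : ClassTable)
                   (M : BüchiMethodTyping P (BüchiAbstraction.finiteAlgebra 𝓑)) where
  open BüchiAbstraction 𝓑
  open Words k hiding (_^ω)
  open Signatures P
  open SignatureEnumeration P
  open Procedure P finiteAlgebra M
  private
    module F* = FiniteJoins M* M*-finite
    module Fω = FiniteJoins M≤ω M≤ω-finite

  U : Sig → Sig → Lang*
  U δ δ′ = fromMaybe ∅ (proj₂ (concretize 𝓑 M δ) δ′)

  open EquationSystem k U

  any⁺ : ∀ {Q : Pred M*.Carrier 0ℓ} {c a} → c ≡ just a → Q a → AnyMaybe Q c
  any⁺ refl q = just q

  any⁻ : ∀ {Q : Pred M*.Carrier 0ℓ} {c} → AnyMaybe Q c → ∃[ a ] (c ≡ just a × Q a)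
  any⁻ (just q) = _ , refl , q

  ∈-entry⁻ : ∀ {u} c → u ∈ fromMaybe ∅ (Maybe.map γ* c) → ∃[ a ] (c ≡ just a × u ∈ γ* a)
  ∈-entry⁻ (just a) u∈ = a , refl , u∈

  ∈-entry⁺ : ∀ {u c a} → c ≡ just a → u ∈ γ* a → u ∈ fromMaybe ∅ (Maybe.map γ* c)
  ∈-entry⁺ refl u∈ = u∈

  α*-least : ∀ {V a} → V ⊆ γ* a → α* V M*.≤ a
  α*-least V⊆ = M*.trans (α*-mono V⊆) (M*.reflexive (α*∘γ* _))

  ≤α*γ* : ∀ a → a M*.≤ α* (γ* a)
  ≤α*γ* a = M*.reflexive (M*.Eq.sym (α*∘γ* a))

  ∙≤α* : ∀ {a b U V} → a M*.≤ α* U → b M*.≤ α* V → (a ∙ b) M*.≤ α* (U ∙* V)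
  ∙≤α* {U = U} {V} a≤ b≤ =
    M*.trans (∙-mono a≤ b≤) (M*.reflexive (M*.Eq.sym (α*-∙ U V)))

  -- The language γ(a) · γ(b) abstracts to a ∙ b, hence lies in γ(a ∙ b).
  γ*-∙ : ∀ {a b u v} → u ∈ γ* a → v ∈ γ* b → (u ++ v) ∈ γ* (a ∙ b)
  γ*-∙ {a} {b} {u} {v} u∈ v∈ =
    γ*-mono (M*.trans (M*.reflexive (α*-∙ (γ* a) (γ* b)))
                      (∙-mono (M*.reflexive (α*∘γ* a)) (M*.reflexive (α*∘γ* b))))
            (γ*∘α* (γ* a ∙* γ* b) (u , v , u∈ , v∈ , refl))

  ≤elem-index : ∀ a → a M*.≤ F*.elem (F*.index a)
  ≤elem-index a = M*.reflexive (M*.Eq.sym (F*.elem-index a))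

  elem-index≤ : ∀ a → F*.elem (F*.index a) M*.≤ a
  elem-index≤ a = M*.reflexive (F*.elem-index a)

  path⇒value : ∀ {δ δ′ u} → u ∈ Path δ δ′ → ∃[ i ] (PathValue δ δ′ i × u ∈ γ* (F*.elem i))
  path⇒value {δ} {δ′} (last u∈) =
    let (a , c≡a , u∈a) = ∈-entry⁻ (coefficient δ δ′) u∈ in
    F*.index a , [ any⁺ c≡a refl ] , γ*-mono (≤elem-index a) u∈a
  path⇒value {δ} (step {y = δ₁} u∈ p refl) =
    let (a , c≡a , u∈a) = ∈-entry⁻ (coefficient δ δ₁) u∈
        (j , value , v∈) = path⇒value p
    in F*.index (a ∙ F*.elem j) , any⁺ c≡a refl ∷ value ,
       γ*-mono (≤elem-index _) (γ*-∙ u∈a v∈)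

  -- A step is never followed by another one from the formal value nothing, so
  -- the tail of a longer path has a proper value.
  value⇒≤α*Path : ∀ {δ δ′ i} → PathValue δ δ′ i → F*.elem i M*.≤ α* (Path δ δ′)
  value⇒≤α*Path [ r ] with any⁻ r
  ... | a , c≡a , refl =
    M*.trans (elem-index≤ a) (M*.trans (≤α*γ* a) (α*-mono λ u∈ → last (∈-entry⁺ c≡a u∈)))
  value⇒≤α*Path (_∷_ {y = _ , nothing} r [ () ])
  value⇒≤α*Path (_∷_ {y = _ , nothing} r (() ∷ _))
  value⇒≤α*Path (_∷_ {y = _ , just j} r value) with any⁻ r
  ... | a , c≡a , refl =
    M*.trans (elem-index≤ (a ∙ F*.elem j))
      (M*.trans (∙≤α* (≤α*γ* a) (value⇒≤α*Path value))
        (α*-mono λ (u , v , u∈ , v∈ , eq) → step (∈-entry⁺ c≡a u∈) v∈ eq))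

  -- A word of a path lies in the concretization of that path's value, hence
  -- in that of the join; by adjunction the join bounds α* (Path δ δ′).
  pathEffect-correct : ∀ δ δ′ → pathEffect δ δ′ M*.≈ α* (Path δ δ′)
  pathEffect-correct δ δ′ = M*.antisym
    (F*.⋁[]-least (pathValue? δ δ′) value⇒≤α*Path)
    (α*-least λ p → let (i , value , u∈) = path⇒value p in
       γ*-mono (F*.⋁[]-upper (pathValue? δ δ′) value) u∈)

  -- The inequality at b = α({ε}) gives α({ε}) ≤ a ∙ α({ε}) ≤ a.
  aboveUnit⇒[]∈ : ∀ {a} → AboveUnit a → [] ∈ γ* a
  aboveUnit⇒[]∈ {a} above = γ*-mono unit≤a (γ*∘α* (_≡ []) refl)
    where
    unit : M*.Carrier
    unit = α* (_≡ [])

    unit≤a : unit M*.≤ a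
    unit≤a = M*.trans (≤elem-index unit) (M*.trans (above (F*.index unit))
      (M*.trans (∙≤α* (≤α*γ* a) (elem-index≤ unit))
        (α*-least λ { (u , _ , u∈ , refl , refl) → subst (_∈ γ* a) (sym (++-identityʳ u)) u∈ })))

  -- Here γ(b) = {ε} · γ(b) ⊆ γ(a ∙ b), and α is left inverse to γ.
  []∈⇒aboveUnit : ∀ {a} → [] ∈ γ* a → AboveUnit a
  []∈⇒aboveUnit {a} []∈ i = M*.trans (≤α*γ* b)
    (α*-least λ v∈ → γ*-∙ []∈ v∈)
    where b = F*.elem i

  silent⇒[]∈ : ∀ {δ δ′} → TransClosure SilentStep δ δ′ → [] ∈ Path δ δ′
  silent⇒[]∈ [ r ]    = let (_ , c≡a , above) = any⁻ r in
                        last (∈-entry⁺ c≡a (aboveUnit⇒[]∈ above))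
  silent⇒[]∈ (r ∷ rs) = let (_ , c≡a , above) = any⁻ r in
                        step (∈-entry⁺ c≡a (aboveUnit⇒[]∈ above)) (silent⇒[]∈ rs) refl

  -- If a concatenation is empty, so are its factors.  The word is kept general
  -- for the induction.
  []∈⇒silent : ∀ {δ δ′ u} → u ∈ Path δ δ′ → u ≡ [] → TransClosure SilentStep δ δ′
  []∈⇒silent {δ} {δ′} (last u∈) refl =
    let (_ , c≡a , []∈) = ∈-entry⁻ (coefficient δ δ′) u∈ in
    [ any⁺ c≡a ([]∈⇒aboveUnit []∈) ]
  []∈⇒silent {δ} (step {y = δ₁} {u = []} u∈ p refl) v≡[] =
    let (_ , c≡a , []∈) = ∈-entry⁻ (coefficient δ δ₁) u∈ in
    any⁺ c≡a ([]∈⇒aboveUnit []∈) ∷ []∈⇒silent p v≡[]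

  silent? : ∀ δ → Dec ([] ∈ Path δ δ)
  silent? δ = map′ silent⇒[]∈ (λ p → []∈⇒silent p refl) (silentCycle? δ)

  open GreatestSolution silent?

  α≤ω-least : ∀ {V u} → words V ⊆ words (γ≤ω u) → α≤ω V M≤ω.≤ u
  α≤ω-least V⊆ = M≤ω.trans (α≤ω-mono V⊆) (M≤ω.reflexive (α≤ω∘γ≤ω _))

  loopEffect-correct : ∀ δ → loopEffect δ M≤ω.≈ α≤ω (loops δ)
  loopEffect-correct δ with does (silentCycle? δ)
  ... | true  = M≤ω.antisym
    (M≤ω.trans (M≤ω.reflexive (M≤ω.Eq.sym (α≤ω∘γ≤ω Fω.greatest))) (α≤ω-mono λ _ → tt))
    (Fω.⊑-greatest _)
  ... | false = M≤ω.Eq.trans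
    (M≤ω.antisym (^ω-mono (M*.reflexive (pathEffect-correct δ δ)))
                 (^ω-mono (M*.reflexive (M*.Eq.sym (pathEffect-correct δ δ)))))
    (M≤ω.Eq.sym (α≤ω-^ω (Path δ δ)))

  summand-correct : ∀ δ δ′ →
    (pathEffect δ δ′ · loopEffect δ′) M≤ω.≈ α≤ω (Path δ δ′ ∙ω loops δ′)
  summand-correct δ δ′ = M≤ω.Eq.trans
    (M≤ω.antisym (·-mono (M*.reflexive path≈) (M≤ω.reflexive loop≈))
                 (·-mono (M*.reflexive (M*.Eq.sym path≈)) (M≤ω.reflexive (M≤ω.Eq.sym loop≈))))
    (M≤ω.Eq.sym (α≤ω-· (Path δ δ′) (loops δ′)))
    where
    path≈ = pathEffect-correct δ δ′
    loop≈ = loopEffect-correct δ′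

  effect-correct : ExcludedMiddle 0ℓ → ∀ η → IsInfinitaryEffectTyping P k (concretize 𝓑 M) η →
                   ∀ δ → effect δ M≤ω.≈ α≤ω (η δ)
  effect-correct em η typing δ = M≤ω.antisym
    (Fω.⋁-least (All.map⁺ (All.universal summand≤ signatures)))
    (α≤ω-least λ w∈ → let (δ′ , w∈summand) = η⊆solution w∈ in
      γ≤ω-mono (summand-below δ′) (γ≤ω∘α≤ω (Path δ δ′ ∙ω loops δ′) w∈summand))
    where
    open IsInfinitaryEffectTyping typing

    η⊆solution : words (η δ) ⊆ solution δ
    η⊆solution = ⊆solution em signatures ∈-signatures η (proj₁ ∘ isSolution) δ

    solution⊆η : solution δ ⊆ words (η δ)
    solution⊆η = isGreatest solutionω (λ δ′ → solution⊆rhs δ′ , rhs⊆solution δ′) δ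

    summand≤ : ∀ δ′ → (pathEffect δ δ′ · loopEffect δ′) M≤ω.≤ α≤ω (η δ)
    summand≤ δ′ = M≤ω.trans (M≤ω.reflexive (summand-correct δ δ′))
      (α≤ω-mono λ w∈ → solution⊆η (δ′ , w∈))

    summand-below : ∀ δ′ → α≤ω (Path δ δ′ ∙ω loops δ′) M≤ω.≤ effect δ
    summand-below δ′ = M≤ω.trans (M≤ω.reflexive (M≤ω.Eq.sym (summand-correct δ δ′)))
      (Fω.⋁-upper (∈-map⁺ (λ δ″ → pathEffect δ δ″ · loopEffect δ″) (∈-signatures δ′)))

theorem5p8 : Σ[ compute ∈ EffectProcedure ]
    (ExcludedMiddle 0ℓ →
    ∀ (k : ℕ) (𝓑 : BüchiAbstraction k) (𝔄 : Words.Lang≤ω k) → IsFaithful 𝓑 𝔄 →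
    ∀ (P : ClassTable) (M𝔄 : BüchiMethodTyping P (BüchiAbstraction.finiteAlgebra 𝓑))
    (ηγ : Assignment P k) → IsInfinitaryEffectTyping P k (concretize 𝓑 M𝔄) ηγ →
    ∀ (δ : Signatures.Sig P) →
    BüchiAbstraction.M≤ω._≈_ 𝓑
    (compute P (BüchiAbstraction.finiteAlgebra 𝓑) M𝔄 δ)
    (BüchiAbstraction.α≤ω 𝓑 (ηγ δ)))
theorem5p8 =
  Procedure.effect ,
  λ em k 𝓑 𝔄 faithful P M𝔄 ηγ isGreatest → Correctness.effect-correct k 𝓑 P M𝔄 em ηγ isGreatest
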